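{- Suppose $\pi$ is a Fishburn permutation with $g(\pi)=\alpha$. Then $\pi$ avoids $3412$ if and only if $\alpha$ avoids $201$. In particular, $|F_n(3412)|=|A_n(201)|$ for all $n\ge 0$.
   Context: A sequence of integers (in particular a permutation in one-line notation) contains a sequence $\beta$ if it has a subsequence with the same length and relative order as $\beta$; otherwise it avoids $\beta$. A Fishburn permutation is a permutation $\pi$ with no subsequence $\pi_j,\pi_{j+1},\pi_k$ such that $j+1<k$, $\pi_j=\pi_k+1$, and $\pi_{j+1}>\pi_j$. An ascent sequence is a sequence $a_1\cdots a_n$ of nonnegative integers with $a_1=0$ and $a_j\le 1+\operatorname{asc}(a_1\cdots a_{j-1})$ for each $j\ge 2$, where $\operatorname{asc}$ counts the indices $i$ with $a_i<a_{i+1}$. $F_n(\sigma)$ is the set of Fishburn permutations of length $n$ avoiding $\sigma$; $A_n(\beta)$ is the set of ascent sequences of length $n$ avoiding $\beta$. The map $g$: a site of a Fishburn permutation of length $m-1$ is a space between two adjacent entries, before the first entry, or after the last entry ($m$ sites in all). A site is active if inserting $m$ into it gives a Fishburn permutation. Active sites are numbered from left to right, starting with $0$. Each Fishburn permutation $\pi$ of length $n$ is constructed uniquely, starting from the empty permutation, by successively inserting $1,2,\ldots,n$ into active sites; $g(\pi)=a_1\cdots a_n$, where $a_m$ is the number of the active site into which $m$ is inserted. It is known (Bousquet-Mélou, Claesson, Dukes, Kitaev) that $g$ is a bijection from Fishburn permutations of length $n$ to ascent sequences of length $n$. -}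

module Defs where

open import Data.Bool using (if_then_else_)
open import Data.Nat using (ℕ; suc; _+_; _≤_; _<_; s≤s; _⊓_; _≟_; _≤?_; _<?_)
open import Data.Nat.Properties using (≤-refl; ≤-trans; n≤1+n; <-irrefl; <⇒≱; m≤n⇒m⊓n≡m)
open import Data.Fin using (Fin; toℕ; cast)
open import Data.Fin.Properties using (any?)
open import Data.List using (List; []; _∷_; _++_; _∷ʳ_; length; lookup; take; drop; map; filter; takeWhile; upTo)
open import Data.List.Properties using (length-++-sucʳ; length-take; take++drop≡id; filter-++; filter-all; filter-reject; map-++; map-cong-local; upTo-∷ʳ)
open import Data.List.Membership.Propositional using (_∈_)
open import Data.List.Relation.Binary.Sublist.Propositional using (_⊆_)
open import Data.List.Relation.Unary.All using (All; []; _∷_; all?)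
import Data.List.Relation.Unary.All as All
import Data.List.Relation.Unary.All.Properties as Allₚ
open import Data.List.Relation.Unary.Unique.Propositional using (Unique)
open import Data.List.Relation.Unary.Unique.DecPropositional _≟_ using (unique?)
open import Data.Product using (Σ-syntax; ∃-syntax; _×_; _,_; proj₂)
open import Function using (_∘_; _⇔_)
open import Level using (0ℓ)
open import Relation.Binary.PropositionalEquality using (_≡_; _≢_; refl; sym; trans; cong; cong₂; module ≡-Reasoning)
open import Relation.Nullary using (¬_; does; ¬?)
open import Relation.Nullary.Decidable using (_×-dec_; dec-true; dec-false)
open import Relation.Unary using (Pred; Decidable)

SameRelativeOrder : List ℕ → List ℕ → Set
SameRelativeOrder γ β =
  Σ[ eq ∈ length γ ≡ length β ]
    (∀ (i j : Fin (length γ)) →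
      lookup γ i < lookup γ j ⇔ lookup β (cast eq i) < lookup β (cast eq j))

Contains : List ℕ → List ℕ → Set
Contains s β = ∃[ γ ] (γ ⊆ s × SameRelativeOrder γ β)

Avoids : List ℕ → List ℕ → Set
Avoids s β = ¬ Contains s β

-- One-line notation for a permutation of {1, …, n}, where n is the length.
IsPermutation : Pred (List ℕ) 0ℓ
IsPermutation π = All (λ v → 1 ≤ v × v ≤ length π) π × Unique π

-- The index j⁺ is j + 1.
HasFishburnPattern : Pred (List ℕ) 0ℓ
HasFishburnPattern π =
  ∃[ j ] ∃[ j⁺ ] ∃[ k ]
    ( toℕ j⁺ ≡ suc (toℕ j)
    × toℕ j⁺ < toℕ k
    × lookup π j ≡ suc (lookup π k)
    × lookup π j < lookup π j⁺ )

IsFishburn : Pred (List ℕ) 0ℓ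
IsFishburn π = IsPermutation π × ¬ HasFishburnPattern π

isPermutation? : Decidable IsPermutation
isPermutation? π = all? (λ v → (1 ≤? v) ×-dec (v ≤? length π)) π ×-dec unique? π

hasFishburnPattern? : Decidable HasFishburnPattern
hasFishburnPattern? π = any? λ j → any? λ j⁺ → any? λ k →
  (toℕ j⁺ ≟ suc (toℕ j))
  ×-dec (toℕ j⁺ <? toℕ k)
  ×-dec (lookup π j ≟ suc (lookup π k))
  ×-dec (lookup π j <? lookup π j⁺)

isFishburn? : Decidable IsFishburn
isFishburn? π = isPermutation? π ×-dec ¬? (hasFishburnPattern? π)

asc : List ℕ → ℕ
asc []           = 0
asc (_ ∷ [])     = 0
asc (x ∷ y ∷ zs) = (if does (x <? y) then 1 else 0) + asc (y ∷ zs)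

-- Indices start at 0 here, so take (toℕ j) lists the entries strictly before
-- index j.  The empty sequence is the ascent sequence of length 0.
IsAscentSequence : Pred (List ℕ) 0ℓ
IsAscentSequence a =
  ∀ (j : Fin (length a)) →
    (toℕ j ≡ 0 → lookup a j ≡ 0) ×
    (1 ≤ toℕ j → lookup a j ≤ 1 + asc (take (toℕ j) a))

-- A site of π is identified with the number s ≤ length π of entries to its left.
insertMax : List ℕ → ℕ → List ℕ
insertMax π s = take s π ++ suc (length π) ∷ drop s π

Active : List ℕ → Pred ℕ 0ℓ
Active π s = IsFishburn (insertMax π s)

active? : ∀ π → Decidable (Active π)
active? π s = isFishburn? (insertMax π s)

-- Numbering the active sites from the left starting with 0 gives s as its
-- number the count of active sites lying to the left of s.
siteNumber : List ℕ → ℕ → ℕ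
siteNumber π s = length (filter (active? π) (upTo s))

-- The permutation present once 1, …, m have been inserted.
restrict : ℕ → List ℕ → List ℕ
restrict m = filter (_≤? m)

position : ℕ → List ℕ → ℕ
position m = length ∘ takeWhile (λ v → ¬? (v ≟ m))

-- The entry at index m (counted from 0) records the insertion of suc m.  That
-- this is the recursive description of g by insertions is g-insertMax below.
g : List ℕ → List ℕ
g π = map (λ m → siteNumber (restrict m π) (position (suc m) (restrict (suc m) π)))
          (upTo (length π))

F : ℕ → List ℕ → Pred (List ℕ) 0ℓ
F n σ π = IsFishburn π × length π ≡ n × Avoids π σ

A : ℕ → List ℕ → Pred (List ℕ) 0ℓ
A n β a = IsAscentSequence a × length a ≡ n × Avoids a β

HasCardinality : Pred (List ℕ) 0ℓ → ℕ → Set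
HasCardinality P k =
  Σ[ xs ∈ List (List ℕ) ] (Unique xs × (∀ x → x ∈ xs ⇔ P x) × length xs ≡ k)

private
  length-insertMax : ∀ π s → length (insertMax π s) ≡ suc (length π)
  length-insertMax π s =
    trans (length-++-sucʳ (take s π) (suc (length π)) (drop s π))
          (cong (suc ∘ length) (take++drop≡id s π))

  restrict-insertMax : ∀ m π s → m ≤ length π → restrict m (insertMax π s) ≡ restrict m π
  restrict-insertMax m π s m≤n = begin
    restrict m (take s π ++ suc (length π) ∷ drop s π)
      ≡⟨ filter-++ (_≤? m) (take s π) _ ⟩
    restrict m (take s π) ++ restrict m (suc (length π) ∷ drop s π)
      ≡⟨ cong (restrict m (take s π) ++_)
           (filter-reject (_≤? m) {xs = drop s π} λ n<m → <⇒≱ n<m m≤n) ⟩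
    restrict m (take s π) ++ restrict m (drop s π)
      ≡⟨ filter-++ (_≤? m) (take s π) (drop s π) ⟨
    restrict m (take s π ++ drop s π)
      ≡⟨ cong (restrict m) (take++drop≡id s π) ⟩
    restrict m π ∎
    where open ≡-Reasoning

  position-++ : ∀ m xs ys → All (_≢ m) xs → position m (xs ++ m ∷ ys) ≡ length xs
  position-++ m [] ys [] rewrite dec-true (m ≟ m) refl = refl
  position-++ m (x ∷ xs) ys (x≢m ∷ xs≢m) rewrite dec-false (x ≟ m) x≢m =
    cong suc (position-++ m xs ys xs≢m)

g-[] : g [] ≡ []
g-[] = refl

g-insertMax : ∀ π s → IsPermutation π → s ≤ length π →
              g (insertMax π s) ≡ g π ∷ʳ siteNumber π s
g-insertMax π s (bounds , _) s≤n = begin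
  map (step π′) (upTo (length π′))
    ≡⟨ cong (map (step π′) ∘ upTo) (length-insertMax π s) ⟩
  map (step π′) (upTo (suc n))
    ≡⟨ cong (map (step π′)) (upTo-∷ʳ n) ⟨
  map (step π′) (upTo n ∷ʳ n)
    ≡⟨ map-++ (step π′) (upTo n) (n ∷ []) ⟩
  map (step π′) (upTo n) ∷ʳ step π′ n
    ≡⟨ cong₂ _∷ʳ_ (map-cong-local (All.map earlier (Allₚ.all-upTo n))) last ⟩
  g π ∷ʳ siteNumber π s ∎
  where
  open ≡-Reasoning
  n = length π
  π′ = insertMax π s

  step : List ℕ → ℕ → ℕ
  step ρ m = siteNumber (restrict m ρ) (position (suc m) (restrict (suc m) ρ))

  earlier : ∀ {m} → m < n → step π′ m ≡ step π m
  earlier {m} m<n = cong₂ siteNumber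
    (restrict-insertMax m π s (≤-trans (n≤1+n m) m<n))
    (cong (position (suc m)) (restrict-insertMax (suc m) π s m<n))

  ≤n : All (_≤ n) π
  ≤n = All.map proj₂ bounds

  ≤1+n : ∀ {v} → v ≤ n → v ≤ suc n
  ≤1+n v≤n = ≤-trans v≤n (n≤1+n n)

  whole : restrict (suc n) π′ ≡ π′
  whole = filter-all (_≤? suc n)
    (Allₚ.++⁺ (Allₚ.take⁺ s (All.map ≤1+n ≤n)) (≤-refl ∷ Allₚ.drop⁺ s (All.map ≤1+n ≤n)))

  last : step π′ n ≡ siteNumber π s
  last = cong₂ siteNumber
    (trans (restrict-insertMax n π s ≤-refl) (filter-all (_≤? n) ≤n))
    (begin
      position (suc n) (restrict (suc n) π′)
        ≡⟨ cong (position (suc n)) whole ⟩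
      position (suc n) π′
        ≡⟨ position-++ (suc n) (take s π) (drop s π)
             (Allₚ.take⁺ s (All.map (λ v≤n v≡1+n → <-irrefl v≡1+n (s≤s v≤n)) ≤n)) ⟩
      length (take s π)
        ≡⟨ length-take s π ⟩
      s ⊓ n
        ≡⟨ m≤n⇒m⊓n≡m s≤n ⟩
      s ∎)

{-# OPTIONS --safe #-}

-- In a Fishburn permutation the site to the right of an entry v is active iff
-- v = 1 or v - 1 stands to the left of v; this never changes as larger values
-- are inserted.  Hence the letter of g(π) recording the insertion of m is the
-- number of v < m, left of m in π, whose sites are active, and all letters can
-- be compared inside the final permutation.  The bottom of an ascent between
-- adjacent entries is active, so between c and a later d > c there is always
-- an active value below d; this turns an occurrence c d a b of 3412 with d
-- least into letters b, c, d of α forming 201.  Conversely, for letters i, j, k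
-- forming 201 one may assume that j stands left of k, and comparing the letters
-- of k and i yields w < i between k and i, so that j k w i is a 3412.
-- For the enumeration, m + 1 lies to the right of m exactly when its letter
-- exceeds that of m, and exactly when its own site is active.  So a nonempty π
-- has 2 + asc α active sites, whence g is a bijection onto ascent sequences.
module Submission where

open import Defs
open import Data.Nat using (ℕ; zero; suc; pred; _+_; _≤_; _<_; z≤n; s≤s; _≟_; _≤?_; _<?_; >-nonZero)
open import Data.Bool using (if_then_else_)
open import Data.Fin using (Fin; zero; suc; toℕ; cast; fromℕ<; #_)
import Data.Fin as Fin
import Data.Fin.Properties as Finₚ
open import Data.List using (List; []; _∷_; _++_; _∷ʳ_; length; lookup; take; drop; map; filter; upTo; cartesianProductWith)
open import Data.List.Membership.DecPropositional _≟_ using (_∈?_)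
open import Data.List.Membership.Propositional using (_∈_; find; lose)
open import Data.List.Membership.Propositional.Properties
open import Data.List.Properties
open import Data.List.Relation.Binary.Sublist.DecPropositional _≟_ using (_⊆?_)
open import Data.List.Relation.Binary.Sublist.Propositional
  using (_⊆_; []; _∷_; ⊆-trans; ⊆-refl; minimum; from∈; to∈) renaming (_∷ʳ_ to infixr 5 _∷ˢ_; lookup to ⊆-lookup)
open import Data.List.Relation.Binary.Sublist.Propositional.Properties
  using (∷ˡ⁻; All-resp-⊆) renaming (++⁺ to ⊆-++⁺; ++⁺ˡ to ⊆-++⁺ˡ; map⁺ to ⊆-map⁺)
open import Data.List.Relation.Unary.All using (All; []; _∷_)
import Data.List.Relation.Unary.All as All
import Data.List.Relation.Unary.All.Properties as Allₚ
open import Data.List.Relation.Unary.AllPairs using (AllPairs; []; _∷_)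
import Data.List.Relation.Unary.AllPairs.Properties as AllPairsₚ
open import Data.List.Relation.Unary.Any using (here; there; any?; index)
open import Data.List.Relation.Unary.Any.Properties using (lookup-index)
open import Data.List.Relation.Unary.Unique.Propositional using (Unique)
import Data.List.Relation.Unary.Unique.Propositional.Properties as Uniqueₚ
open import Data.List.Reverse using (Reverse; reverseView; []; _∶_∶ʳ_)
open import Data.Nat.Induction using (<-rec)
open import Data.Nat.Properties hiding (_≟_; _<?_; _≤?_)
open import Data.Product using (∃-syntax; _×_; _,_; proj₁; proj₂)
open import Data.Sum using (_⊎_; inj₁; inj₂)
import Data.Sum as Sum
open import Function using (_∘_; id; _⇔_; mk⇔; Equivalence)
open import Level using (0ℓ)
open import Relation.Binary.Definitions using (tri<; tri≈; tri>)
open import Relation.Binary.PropositionalEquality using (_≡_; _≢_; refl; sym; trans; cong; cong₂; subst; module ≡-Reasoning)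
open import Relation.Nullary using (¬_; Dec; yes; no; contradiction; ¬?)
open import Relation.Nullary.Decidable
  using (_×-dec_; _⊎-dec_; _→-dec_; decidable-stable; dec-true; dec-false; from-yes; map′)
open import Relation.Unary using (Pred; Decidable)

private variable
  a b c d i j k m n s t u v w x y z : ℕ
  π ρ α γ ws xs ys zs : List ℕ
  P Q : Pred ℕ 0ℓ

-- Counting with decidable predicates

count : Decidable P → List ℕ → ℕ
count P? xs = length (filter P? xs)

count-mono : (P? : Decidable P) (Q? : Decidable Q) → ∀ xs → (∀ {x} → x ∈ xs → P x → Q x) →
             count P? xs ≤ count Q? xs
count-mono P? Q? [] f = z≤n
count-mono P? Q? (x ∷ xs) f with P? x | Q? x | count-mono P? Q? xs (f ∘ there)
... | yes p | yes q | rec = s≤s rec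
... | yes p | no ¬q | rec = contradiction (f (here refl) p) ¬q
... | no ¬p | yes q | rec = m≤n⇒m≤1+n rec
... | no ¬p | no ¬q | rec = rec

count-strict : (P? : Decidable P) (Q? : Decidable Q) → ∀ xs → (∀ {x} → x ∈ xs → P x → Q x) →
               x ∈ xs → ¬ P x → Q x → count P? xs < count Q? xs
count-strict P? Q? (x ∷ xs) f (here refl) ¬p q with P? x | Q? x
... | yes p | _     = contradiction p ¬p
... | no _  | no ¬q = contradiction q ¬q
... | no _  | yes _ = s≤s (count-mono P? Q? xs (f ∘ there))
count-strict P? Q? (y ∷ xs) f (there x∈) ¬p q
  with P? y | Q? y | count-strict P? Q? xs (f ∘ there) x∈ ¬p q
... | yes _ | yes _ | rec = s≤s rec
... | yes p | no ¬q | rec = contradiction (f (here refl) p) ¬q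
... | no _  | yes _ | rec = m≤n⇒m≤1+n rec
... | no _  | no _  | rec = rec

-- Without such an entry `Q` would imply `P` on `xs`, and `count-mono` would reverse the inequality.
-- The search is decidable, so a witness is found.
count-witness : (P? : Decidable P) (Q? : Decidable Q) → ∀ xs → count P? xs < count Q? xs →
                ∃[ x ] (x ∈ xs × Q x × ¬ P x)
count-witness P? Q? xs P<Q with any? (λ x → Q? x ×-dec ¬? (P? x)) xs
... | yes w = find w
... | no ¬w = contradiction P<Q (≤⇒≯ (count-mono Q? P? xs λ {x} x∈ q →
  decidable-stable (P? x) λ ¬p → ¬w (lose x∈ (q , ¬p))))

count-cong : (P? : Decidable P) (Q? : Decidable Q) → ∀ xs →
             (∀ {x} → x ∈ xs → P x → Q x) → (∀ {x} → x ∈ xs → Q x → P x) → count P? xs ≡ count Q? xs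
count-cong P? Q? xs f g = ≤-antisym (count-mono P? Q? xs f) (count-mono Q? P? xs g)

count-++ : (P? : Decidable P) → ∀ xs ys → count P? (xs ++ ys) ≡ count P? xs + count P? ys
count-++ P? xs ys = trans (cong length (filter-++ P? xs ys)) (length-++ (filter P? xs))

-- Left-to-right order of entries

Before : List ℕ → ℕ → ℕ → Set
Before π u v = (u ∷ v ∷ []) ⊆ π

before? : ∀ π u v → Dec (Before π u v)
before? π u v = (u ∷ v ∷ []) ⊆? π

∈ˡ : Before π u v → u ∈ π
∈ˡ = to∈

∈ʳ : Before π u v → v ∈ π
∈ʳ = to∈ ∘ ∷ˡ⁻

head∉tail : Unique (x ∷ xs) → ¬ x ∈ xs
head∉tail (x≢ ∷ _) x∈ = All.lookup x≢ x∈ refl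

-- Since entries are distinct, both sublists meet `v` at the same place, so `u` can be put in front
-- of the second.
before-∷-⊆ : Unique π → Before π u v → (v ∷ ws) ⊆ π → (u ∷ v ∷ ws) ⊆ π
before-∷-⊆ (_ ∷ un) (y ∷ˢ p) (y ∷ˢ q)   = y ∷ˢ before-∷-⊆ un p q
before-∷-⊆ un       (y ∷ˢ p) (refl ∷ q) = contradiction (∈ʳ p) (head∉tail un)
before-∷-⊆ _        (refl ∷ p) (y ∷ˢ q) = refl ∷ q
before-∷-⊆ un       (refl ∷ p) (refl ∷ q) = contradiction (to∈ p) (head∉tail un)

before-irrefl : Unique π → ¬ Before π u u
before-irrefl (_ ∷ un) (y ∷ˢ p)   = before-irrefl un p
before-irrefl un       (refl ∷ p) = head∉tail un (to∈ p)

before-trans : Unique π → Before π u v → Before π v w → Before π u w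
before-trans un p q = ⊆-trans (refl ∷ _ ∷ˢ refl ∷ []) (before-∷-⊆ un p q)

before-asym : Unique π → Before π u v → ¬ Before π v u
before-asym un p q = before-irrefl un (before-trans un p q)

before-total : u ∈ π → v ∈ π → u ≢ v → Before π u v ⊎ Before π v u
before-total (here refl) (here refl) u≢v = contradiction refl u≢v
before-total (here refl) (there v∈)  u≢v = inj₁ (refl ∷ from∈ v∈)
before-total (there u∈)  (here refl) u≢v = inj₂ (refl ∷ from∈ u∈)
before-total (there u∈)  (there v∈)  u≢v = Sum.map (_ ∷ˢ_) (_ ∷ˢ_) (before-total u∈ v∈ u≢v)

-- Fishburn patterns and active sites

-- Structural counterpart of `HasFishburnPattern`: adjacency is matched at the head and the third
-- entry is a membership, so no index arithmetic arises.
data FishburnPattern : List ℕ → Set where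
  here  : suc z < y → z ∈ zs → FishburnPattern (suc z ∷ y ∷ zs)
  there : FishburnPattern xs → FishburnPattern (x ∷ xs)

-- For a Fishburn permutation of length n, the site just to the right of v is
-- active exactly when v = 1 or v - 1 stands to the left of v, because inserting
-- n + 1 there must not create a pattern v, n + 1, v - 1.
ActiveAfter : List ℕ → Pred ℕ 0ℓ
ActiveAfter π v = ¬ Before π v (pred v)

activeAfter? : ∀ π → Decidable (ActiveAfter π)
activeAfter? π v = ¬? (before? π v (pred v))

activeAfter-∷ : Unique (y ∷ π) → x ∈ π → ActiveAfter π x → ActiveAfter (y ∷ π) x
activeAfter-∷ un x∈ act (_ ∷ˢ p)   = act p
activeAfter-∷ un x∈ act (refl ∷ _) = head∉tail un x∈

-- A `pred x` to the right of `x` would lie beyond the larger `y` and complete a Fishburn pattern.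
activeAfter-ascent : Unique (x ∷ y ∷ zs) → ¬ FishburnPattern (x ∷ y ∷ zs) → x < y →
                     ActiveAfter (x ∷ y ∷ zs) x
activeAfter-ascent un ¬fp x<y (_ ∷ˢ p) = head∉tail un (∈ˡ p)
-- Here `pred zero` is `zero`, which would have to occur twice.
activeAfter-ascent {x = zero}  un ¬fp x<y (refl ∷ p) = head∉tail un (to∈ p)
activeAfter-ascent {x = suc z} un ¬fp x<y (refl ∷ p) with to∈ p
... | here refl = 1+n≰n (<⇒≤ x<y)
... | there z∈  = ¬fp (here x<y z∈)

-- Going right from `c`, the entries start below `d` and eventually reach it. The entry `x` just
-- before the first one that is at least `d` is the bottom of an ascent, hence active.
active-between : Unique π → ¬ FishburnPattern π → Before π c d → c < d →
  ∃[ x ] (x < d × ActiveAfter π x × (x ≡ c ⊎ Before π c x) × Before π x d)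
active-between un@(_ ∷ un′) ¬fp (y ∷ˢ p) c<d
  with x , x<d , act , c≤x , xd ← active-between un′ (¬fp ∘ there) p c<d
  = x , x<d , activeAfter-∷ un (∈ˡ xd) act , Sum.map₂ (y ∷ˢ_) c≤x , y ∷ˢ xd
active-between {π = c ∷ y ∷ ys} {d = d} un@(_ ∷ un′) ¬fp (refl ∷ p) c<d with d ≤? y | p
... | yes d≤y | _ = c , c<d , activeAfter-ascent un ¬fp (≤-trans c<d d≤y) , inj₁ refl , refl ∷ p
... | no d≰y | refl ∷ _ = contradiction ≤-refl d≰y
... | no d≰y | _ ∷ˢ q
  with x , x<d , act , _ , xd ← active-between un′ (¬fp ∘ there) (refl ∷ q) (≰⇒> d≰y)
  = x , x<d , activeAfter-∷ un (∈ˡ xd) act , inj₂ (refl ∷ from∈ (∈ˡ xd)) , c ∷ˢ xd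

-- The entries counted are those whose sites are active and to the left of m
-- when m is inserted, not counting the site before the first entry; the latter
-- makes up for the site of m itself, which is not to its own left.
Counted : List ℕ → ℕ → Pred ℕ 0ℓ
Counted π m v = v < m × ActiveAfter π v × Before π v m

counted? : ∀ π m → Decidable (Counted π m)
counted? π m v = (v <? m) ×-dec activeAfter? π v ×-dec before? π v m

letter : List ℕ → ℕ → ℕ
letter π m = count (counted? π m) π

letter-< : (∀ {x} → Counted π u x → Counted π v x) → ¬ Counted π u x → Counted π v x →
           letter π u < letter π v
letter-< {π = π} u⊆v ¬u v = count-strict (counted? _ _) (counted? _ _) π (λ _ → u⊆v) (∈ˡ (proj₂ (proj₂ v))) ¬u v

letter-≤ : (∀ {x} → Counted π u x → Counted π v x) → letter π u ≤ letter π v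
letter-≤ {π = π} u⊆v = count-mono (counted? _ _) (counted? _ _) π (λ _ → u⊆v)

letter-witness : letter π u < letter π v → ∃[ x ] (Counted π v x × ¬ Counted π u x)
letter-witness {π = π} u<v with x , _ , p ← count-witness (counted? _ _) (counted? _ _) π u<v = x , p

-- Occurrences of 3412 and of 201

Occurrence3412 : Pred (List ℕ) 0ℓ
Occurrence3412 π = ∃[ a ] ∃[ b ] ∃[ c ] ∃[ d ] ((c ∷ d ∷ a ∷ b ∷ []) ⊆ π × a < b × b < c × c < d)

-- The value whose insertion a letter records gives the place of that letter, so the places of 2, 0,
-- 1 are compared as values `i < j < k`.
Letters201 : Pred (List ℕ) 0ℓ
Letters201 π = ∃[ i ] ∃[ j ] ∃[ k ] (i ∈ π × j ∈ π × k ∈ π × i < j × j < k ×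
  letter π j < letter π k × letter π k < letter π i)

module _ (un : Unique π) (1≤π : All (1 ≤_) π) (all∈ : ∀ {u v} → v ∈ π → 1 ≤ u → u ≤ v → u ∈ π) where

  pred-before : v ∈ π → 1 < v → ActiveAfter π v → Before π (pred v) v
  pred-before {suc (suc v)} v∈ _ act with before-total (all∈ v∈ (s≤s z≤n) (n≤1+n (suc v))) v∈ (<⇒≢ ≤-refl)
  ... | inj₁ p = p
  ... | inj₂ p = contradiction p act
  pred-before {suc zero} v∈ (s≤s ())

  -- The 1 of the occurrence is first replaced by an active value `a < b`; then a descent on `d`
  -- follows. In the end the letters of `b`, `c`, `d` play the roles of 2, 0, 1.
  3412⇒201 : ¬ FishburnPattern π → Occurrence3412 π → Letters201 π
  3412⇒201 ¬fp (a₀ , b , _ , _ , cdab , a₀<b , b<c , c<d)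
    with a , a<b , act , a₀≤a , ab ← active-between un ¬fp (∷ˡ⁻ (∷ˡ⁻ cdab)) a₀<b
    = search _ b<c c<d (⊆-trans (refl ∷ refl ∷ _ ∷ˢ _ ∷ˢ []) cdab) da
    where
    d-a₀ = ⊆-trans (_ ∷ˢ refl ∷ refl ∷ _ ∷ˢ []) cdab

    da : Before π _ a
    da = Sum.[ (λ a≡a₀ → subst (Before π _) (sym a≡a₀) d-a₀) , before-trans un d-a₀ ]′ a₀≤a

    1≤b : 1 ≤ b
    1≤b = All.lookup 1≤π (∈ʳ ab)

    -- Taking d least, no value in (b , d) to the left of a is active; hence
    -- the letters of c and d count entries below b only.
    least : b < c → c < d → Before π c d → Before π d a →
            (∀ {t} → b < t → t < d → Before π t a → ¬ ActiveAfter π t) → Letters201 π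
    least {c = c} {d = d} b<c c<d cd da inactive =
      b , c , d , ∈ʳ ab , ∈ˡ cd , ∈ʳ cd , b<c , c<d , c<ₗd , d<ₗb
      where
      c<ₗd : letter π c < letter π d
      c<ₗd with active-between un ¬fp cd c<d
      -- An active `c` would lie in `(b , d)` and left of `a`, which `inactive` excludes.
      ... | x , x<d , actx , inj₁ refl , xd =
        contradiction actx (inactive b<c c<d (before-trans un cd da))
      ... | x , x<d , actx , inj₂ cx , xd = letter-<
        (λ (x<c , act , xc) → <-trans x<c c<d , act , before-trans un xc cd)
        (λ (_ , _ , xc) → before-asym un xc cx)
        (x<d , actx , xd)
      d<ₗb : letter π d < letter π b
      -- The active `a` is counted for `b` but stands right of `d`, so the inequality is strict.
      d<ₗb = letter-< below (λ (_ , _ , ad) → before-asym un ad da) (a<b , act , ab)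
        where
        below : Counted π d x → Counted π b x
        below {x = x} (x<d , act , xd) with <-cmp x b
        ... | tri< x<b _ _ = x<b , act , before-trans un xd (before-trans un da ab)
        ... | tri≈ _ refl _ = contradiction (before-trans un xd da) (before-asym un ab)
        ... | tri> _ _ b<x = contradiction act (inactive b<x x<d (before-trans un xd da))

    search : ∀ d {c} → b < c → c < d → Before π c d → Before π d a → Letters201 π
    search = <-rec _ step
      where
      step : ∀ d → (∀ {t} → t < d → ∀ {c} → b < c → c < t → Before π c t → Before π t a → Letters201 π) →
             ∀ {c} → b < c → c < d → Before π c d → Before π d a → Letters201 π
      step d rec b<c c<d cd da
        with any? (λ t → (b <? t) ×-dec (t <? d) ×-dec before? π t a ×-dec activeAfter? π t) π
      ... | no none = least b<c c<d cd da
        λ b<t t<d ta act → none (lose (∈ˡ ta) (b<t , t<d , ta , act))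
      ... | yes some with find some
      -- The active value `suc t` has `t` to its left, so `t` and `suc t` replace `c` and `d`.
      ...   | suc t , t∈ , b<1+t , t<d , ta , act = rec t<d b<t ≤-refl t-1+t ta
        where
        t-1+t = pred-before t∈ (≤-<-trans 1≤b b<1+t) act
        b<t : b < t
        -- `t` stands left of `a` and `b` right of it, so they differ.
        b<t = ≤∧≢⇒< (≤-pred b<1+t) λ { refl → before-asym un ab (before-trans un t-1+t ta) }

  -- The larger letter of `i` provides an active `w < i` left of `i` that is not counted for `v`. As
  -- `w < v`, it must stand right of `v`, and `u v w i` is the occurrence.
  3412-from : i ∈ π → i < u → u < v → Before π u v → letter π v < letter π i → Occurrence3412 π
  3412-from {i} {u} {v} i∈ i<u u<v uv v<ₗi with w , (w<i , act , wi) , w∉v ← letter-witness v<ₗi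
    with before-total (∈ʳ uv) (∈ˡ wi) (λ { refl → <-asym (<-trans i<u u<v) w<i })
  ... | inj₁ vw = w , i , u , v , before-∷-⊆ un uv (before-∷-⊆ un vw wi) , w<i , i<u , u<v
  ... | inj₂ wv = contradiction (<-trans w<i (<-trans i<u u<v) , act , wv) w∉v

  201⇒3412 : Letters201 π → Occurrence3412 π
  201⇒3412 (i , j , k , i∈ , j∈ , k∈ , i<j , j<k , j<ₗk , k<ₗi) with before-total j∈ k∈ (<⇒≢ j<k)
  ... | inj₁ jk = 3412-from i∈ i<j j<k jk k<ₗi
  -- An active value v in (j , k) preceding k makes the letter of k exceed that
  -- of j; then v - 1 and v can replace j and k.
  ... | inj₂ kj with letter-witness j<ₗk
  ...   | v , (v<k , act , vk) , v∉j = replace v v<k act vk v∉j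
    where
    replace : ∀ v → v < k → ActiveAfter π v → Before π v k → ¬ Counted π j v → Occurrence3412 π
    replace v v<k act vk v∉j with <-cmp v j
    ... | tri< v<j _ _ = contradiction (v<j , act , before-trans un vk kj) v∉j
    ... | tri≈ _ refl _ = contradiction kj (before-asym un vk)
    replace (suc v) v<k act vk v∉j | tri> _ _ j<1+v =
      -- Everything counted for `suc v` is counted for the larger `k` further right, so the letter
      -- of `suc v` also stays below that of `i`.
      3412-from i∈ (<-≤-trans i<j (≤-pred j<1+v)) ≤-refl v-1+v (≤-<-trans
        (letter-≤ λ (x<1+v , actx , xv) → <-trans x<1+v v<k , actx , before-trans un xv vk) k<ₗi)
      where
      v-1+v : Before π v (suc v)
      v-1+v = pred-before (∈ˡ vk) (≤-<-trans (All.lookup 1≤π j∈) j<1+v) act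

-- Inserting the maximum

length-∷ʳ : ∀ xs → length (xs ∷ʳ x) ≡ suc (length xs)
length-∷ʳ xs = trans (length-++ xs) (+-comm (length xs) 1)

count-accept-∷ʳ : (P? : Decidable P) → ∀ xs → P x → count P? (xs ∷ʳ x) ≡ suc (count P? xs)
count-accept-∷ʳ P? xs p = trans (count-++ P? xs _)
  (trans (cong (λ zs → count P? xs + length zs) (filter-accept P? p)) (+-comm (count P? xs) 1))

count-reject-∷ʳ : (P? : Decidable P) → ∀ xs → ¬ P x → count P? (xs ∷ʳ x) ≡ count P? xs
count-reject-∷ʳ P? xs ¬p = trans (count-++ P? xs _)
  (trans (cong (λ zs → count P? xs + length zs) (filter-reject P? ¬p)) (+-identityʳ (count P? xs)))

count-uninsert : (P? : Decidable P) → ∀ xs {ys} → ¬ P x → count P? (xs ++ x ∷ ys) ≡ count P? (xs ++ ys)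
count-uninsert P? xs {ys} ¬p = trans (count-++ P? xs _)
  (trans (cong (λ zs → count P? xs + length zs) (filter-reject P? ¬p)) (sym (count-++ P? xs ys)))

count-insert : (P? : Decidable P) → ∀ xs {ys} → P x → count P? (xs ++ x ∷ ys) ≡ suc (count P? (xs ++ ys))
count-insert P? xs {ys} p = trans (count-++ P? xs _)
  (trans (cong (λ zs → count P? xs + length zs) (filter-accept P? p))
    (trans (+-suc (count P? xs) _) (cong suc (sym (count-++ P? xs ys)))))

⊆-insert : ∀ xs → xs ++ ys ⊆ xs ++ x ∷ ys
⊆-insert xs = ⊆-++⁺ (⊆-refl {x = xs}) (_ ∷ˢ ⊆-refl)

∈-uninsert : ∀ xs → v ∈ xs ++ x ∷ ys → v ≡ x ⊎ v ∈ xs ++ ys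
∈-uninsert []       (here v≡x)  = inj₁ v≡x
∈-uninsert []       (there v∈)  = inj₂ v∈
∈-uninsert (x ∷ xs) (here v≡x)  = inj₂ (here v≡x)
∈-uninsert (x ∷ xs) (there v∈)  = Sum.map₂ there (∈-uninsert xs v∈)

⊆-uninsert : ∀ xs → ¬ x ∈ ws → ws ⊆ xs ++ x ∷ ys → ws ⊆ xs ++ ys
⊆-uninsert []       x∉ (_ ∷ˢ p)   = p
⊆-uninsert []       x∉ (refl ∷ p) = contradiction (here refl) x∉
⊆-uninsert (y ∷ xs) x∉ (_ ∷ˢ p)   = y ∷ˢ ⊆-uninsert xs x∉ p
⊆-uninsert (y ∷ xs) x∉ (refl ∷ p) = refl ∷ ⊆-uninsert xs (x∉ ∘ there) p

unique-⊆ : xs ⊆ ys → Unique ys → Unique xs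
unique-⊆ []         []         = []
unique-⊆ (_ ∷ˢ p)   (_ ∷ un)   = unique-⊆ p un
unique-⊆ (refl ∷ p) (y≢ ∷ un) = All-resp-⊆ p y≢ ∷ unique-⊆ p un

unique-insert : ∀ xs → ¬ x ∈ xs ++ ys → Unique (xs ++ ys) → Unique (xs ++ x ∷ ys)
unique-insert []       x∉ un        = All.tabulate (λ { v∈ refl → x∉ v∈ }) ∷ un
unique-insert (y ∷ xs) x∉ (y≢ ∷ un) = All.tabulate y∉ ∷ unique-insert xs (x∉ ∘ there) un
  where
  y∉ : v ∈ xs ++ _ ∷ _ → y ≢ v
  y∉ v∈ refl with ∈-uninsert xs v∈
  ... | inj₁ refl = x∉ (here refl)
  ... | inj₂ y∈   = All.lookup y≢ y∈ refl

unique-uninsert : ∀ xs → Unique (xs ++ x ∷ ys) → ¬ x ∈ xs ++ ys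
unique-uninsert []       un       = head∉tail un
unique-uninsert (y ∷ xs) un       (here refl) = head∉tail un (∈-insert xs)
unique-uninsert (y ∷ xs) (_ ∷ un) (there x∈)  = unique-uninsert xs un x∈

lookup-≢ : Unique xs → ∀ {i j} → i Fin.< j → lookup xs i ≢ lookup xs j
lookup-≢ (x≢ ∷ un) {zero}  {suc j} _ = All.lookup x≢ (∈-lookup j)
lookup-≢ (x≢ ∷ un) {suc i} {suc j} (s≤s i<j) = lookup-≢ un i<j

pred-<-length : 1 ≤ v × v ≤ n → pred v < n
pred-<-length {suc v} (_ , v<n) = v<n

-- If `u` were missing, `u ∷ π` would have more distinct values than the range from 1 to `length π`
-- allows. `pred` shifts this range to start at 0 for the pigeonhole principle on `Fin`.
∈-permutation : IsPermutation π → 1 ≤ u → u ≤ length π → u ∈ π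
∈-permutation {π} {u} (bounds , un) 1≤u u≤n = decidable-stable (u ∈? π) stable
  where
  bound : ∀ i → 1 ≤ lookup (u ∷ π) i × lookup (u ∷ π) i ≤ length π
  bound i = All.lookup ((1≤u , u≤n) ∷ bounds) (∈-lookup i)

  stable : ¬ ¬ u ∈ π
  stable u∉ with i , j , i<j , eq ← Finₚ.pigeonhole ≤-refl (λ i → fromℕ< (pred-<-length (bound i))) =
    lookup-≢ (unique-insert [] u∉ un) i<j
      (pred-injective ⦃ >-nonZero (proj₁ (bound i)) ⦄ ⦃ >-nonZero (proj₁ (bound j)) ⦄
        (Finₚ.fromℕ<-injective _ _ _ _ eq))

fishburnPattern⁺ : ∀ π → HasFishburnPattern π → FishburnPattern π
fishburnPattern⁺ (x ∷ y ∷ zs) (zero , suc zero , suc (suc k) , _ , _ , refl , x<y) = here x<y (∈-lookup k)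
fishburnPattern⁺ (x ∷ π) (suc j , suc j⁺ , suc k , eq , j⁺<k , p , q) =
  there (fishburnPattern⁺ π (j , j⁺ , k , suc-injective eq , ≤-pred j⁺<k , p , q))
fishburnPattern⁺ (x ∷ y ∷ zs) (zero , suc zero , suc zero , _ , s≤s () , _)
fishburnPattern⁺ (x ∷ π) (_ , _ , zero , _ , () , _)

fishburnPattern⁻ : FishburnPattern π → HasFishburnPattern π
fishburnPattern⁻ (here x<y z∈) = zero , suc zero , suc (suc (index z∈)) ,
  refl , s≤s (s≤s z≤n) , cong suc (lookup-index z∈) , x<y
fishburnPattern⁻ (there p) with j , j⁺ , k , eq , j⁺<k , p , q ← fishburnPattern⁻ p =
  suc j , suc j⁺ , suc k , cong suc eq , s≤s j⁺<k , p , q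

∉-large : All (_< x) xs → ¬ x ∈ xs
∉-large <x x∈ = <-irrefl refl (All.lookup <x x∈)

below-suc-length : IsPermutation π → All (_< suc (length π)) π
below-suc-length (bounds , _) = All.map (s≤s ∘ proj₂) bounds

-- When `x` separates the adjacent pair of the pattern, it becomes the new ascent top.
pattern-insert : ∀ xs → All (_< x) (xs ++ ys) → FishburnPattern (xs ++ ys) → FishburnPattern (xs ++ x ∷ ys)
pattern-insert [] _ p = there p
pattern-insert (_ ∷ [])     (z<x ∷ _) (here _ z∈)   = here z<x (there z∈)
pattern-insert (_ ∷ [])     _ (there p)             = there (there p)
pattern-insert (_ ∷ _ ∷ xs) _ (here z<y z∈)         = here z<y (⊆-lookup (⊆-insert xs) z∈)
pattern-insert (_ ∷ y ∷ xs) (_ ∷ <x) (there p)      = there (pattern-insert (y ∷ xs) <x p)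

pattern-new : ∀ zs → suc z < x → z ∈ ys → FishburnPattern ((zs ∷ʳ suc z) ++ x ∷ ys)
pattern-new []       z<x z∈ = here z<x z∈
pattern-new (_ ∷ zs) z<x z∈ = there (pattern-new zs z<x z∈)

-- The maximum `x` can neither start an ascent nor be the lowest entry of a pattern. So either the
-- pattern does without `x`, or `x` is its top, right after `suc z`.
pattern-uninsert : ∀ xs → All (_< x) (xs ++ ys) → FishburnPattern (xs ++ x ∷ ys) →
  FishburnPattern (xs ++ ys) ⊎ (∃[ zs ] ∃[ z ] (xs ≡ zs ∷ʳ suc z × z ∈ ys))
pattern-uninsert []       (y<x ∷ _) (here x<y _)    = contradiction x<y (<⇒≯ y<x)
pattern-uninsert []       _         (there p)       = inj₁ p
pattern-uninsert (_ ∷ []) _         (here _ z∈)     = inj₂ ([] , _ , refl , z∈)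
pattern-uninsert (_ ∷ []) (_ ∷ y<x ∷ _) (there (here x<y _)) = contradiction x<y (<⇒≯ y<x)
pattern-uninsert (_ ∷ []) _         (there (there p)) = inj₁ (there p)
pattern-uninsert (_ ∷ _ ∷ xs) (z<x ∷ _) (here z<y z∈) with ∈-uninsert xs z∈
... | inj₁ refl = contradiction z<x (<⇒≯ ≤-refl)
... | inj₂ z∈′  = inj₁ (here z<y z∈′)
pattern-uninsert (w ∷ y ∷ xs) (_ ∷ <x) (there p) =
  Sum.map there (λ (zs , z , eq , z∈) → w ∷ zs , z , cong (w ∷_) eq , z∈) (pattern-uninsert (y ∷ xs) <x p)

module _ (xs ys : List ℕ) where

  private
    σ σ⁺ : List ℕ
    N : ℕ
    σ = xs ++ ys
    N = suc (length σ)
    σ⁺ = xs ++ N ∷ ys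

  insertMax-++ : insertMax σ (length xs) ≡ σ⁺
  insertMax-++ = split xs N
    where
    split : ∀ xs x → take (length xs) (xs ++ ys) ++ x ∷ drop (length xs) (xs ++ ys) ≡ xs ++ x ∷ ys
    split []       x = refl
    split (y ∷ xs) x = cong (y ∷_) (split xs x)

  length-insert : length σ⁺ ≡ N
  length-insert = length-++-sucʳ xs N ys

  permutation-insert : IsPermutation σ → IsPermutation σ⁺
  permutation-insert perm@(bounds , un) =
    All.tabulate bound , unique-insert xs (∉-large (below-suc-length perm)) un
    where
    bound : v ∈ σ⁺ → 1 ≤ v × v ≤ length σ⁺
    bound v∈ rewrite length-insert with ∈-uninsert xs v∈
    ... | inj₁ refl = s≤s z≤n , ≤-refl
    ... | inj₂ v∈σ with 1≤v , v≤n ← All.lookup bounds v∈σ = 1≤v , m≤n⇒m≤1+n v≤n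

  permutation-uninsert : IsPermutation σ⁺ → IsPermutation σ
  permutation-uninsert perm@(bounds , un) = All.tabulate bound , unique-⊆ (⊆-insert xs) un
    where
    bound : v ∈ σ → 1 ≤ v × v ≤ length σ
    bound {v} v∈ with 1≤v , v≤n ← All.lookup bounds (⊆-lookup (⊆-insert xs) v∈) =
      1≤v , ≤-pred (≤∧≢⇒< (≤-trans v≤n (≤-reflexive length-insert)) λ { refl → unique-uninsert xs un v∈ })

  fishburn-uninsert : IsFishburn σ⁺ → IsFishburn σ
  fishburn-uninsert (perm , ¬fp) = perm′ ,
    ¬fp ∘ fishburnPattern⁻ ∘ pattern-insert xs (below-suc-length perm′) ∘ fishburnPattern⁺ σ
    where perm′ = permutation-uninsert perm

  fishburn-insert : IsFishburn σ → (∀ {zs z} → xs ≡ zs ∷ʳ suc z → ¬ z ∈ ys) → IsFishburn σ⁺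
  fishburn-insert (perm , ¬fp) z∉ = permutation-insert perm , λ fp →
    Sum.[ ¬fp ∘ fishburnPattern⁻ , (λ (_ , _ , eq , z∈) → z∉ eq z∈) ]′
      (pattern-uninsert xs (below-suc-length perm) (fishburnPattern⁺ σ⁺ fp))

-- Generation by insertions, and activity of sites

-- An induction principle that removes the largest value; a site is given by the splitting
-- `xs ++ ys`.
data Built : List ℕ → Set where
  []     : Built []
  insert : ∀ xs ys → let σ = xs ++ ys; σ⁺ = xs ++ suc (length σ) ∷ ys in
           Built σ → IsFishburn σ⁺ → Built σ⁺

fishburn⇒built : ∀ n → length π ≡ n → IsFishburn π → Built π
fishburn⇒built {[]} zero _ _ = []
fishburn⇒built (suc n) eq fish
  with xs , ys , refl ← ∈-∃++ (∈-permutation (proj₁ fish) (s≤s z≤n) (≤-reflexive (sym eq))) =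
  extend n-eq (fishburn⇒built n n-eq (uninsert n-eq fish)) fish
  where
  n-eq : length (xs ++ ys) ≡ n
  n-eq = suc-injective (trans (sym (length-++-sucʳ xs (suc n) ys)) eq)

  uninsert : length (xs ++ ys) ≡ m → IsFishburn (xs ++ suc m ∷ ys) → IsFishburn (xs ++ ys)
  uninsert refl = fishburn-uninsert xs ys

  extend : length (xs ++ ys) ≡ m → Built (xs ++ ys) → IsFishburn (xs ++ suc m ∷ ys) → Built (xs ++ suc m ∷ ys)
  extend refl = insert xs ys

built⇒fishburn : Built π → IsFishburn π
built⇒fishburn []                   = ([] , []) , λ ()
built⇒fishburn (insert _ _ _ fish) = fish

after⇒before : ∀ xs → w ∈ ys → Before (xs ++ x ∷ ys) x w
after⇒before xs w∈ = ⊆-++⁺ˡ xs (refl ∷ from∈ w∈)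

before⇒after : ∀ xs → Unique (xs ++ x ∷ ys) → Before (xs ++ x ∷ ys) x w → w ∈ ys
before⇒after []       un       (_ ∷ˢ p)   = contradiction (∈ˡ p) (head∉tail un)
before⇒after []       un       (refl ∷ p) = to∈ p
before⇒after (_ ∷ xs) (_ ∷ un) (_ ∷ˢ p)   = before⇒after xs un p
before⇒after (_ ∷ xs) un       (refl ∷ p) = contradiction (∈-insert xs) (head∉tail un)

active-zero : IsFishburn π → Active π 0
active-zero {π} fish = fishburn-insert [] π fish λ { {[]} () ; {_ ∷ _} () }

active⇒activeAfter : ∀ zs → IsFishburn ((zs ∷ʳ x) ++ ys) → Active ((zs ∷ʳ x) ++ ys) (length (zs ∷ʳ x)) →
                     ActiveAfter ((zs ∷ʳ x) ++ ys) x
active⇒activeAfter {x} {ys} zs ((bounds , un) , _) act bef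
  with All.lookup bounds (∈-++⁺ˡ (∈-insert zs))
-- Entries are positive, so `x` is some `suc z`; the inserted maximum would form a pattern with
-- `suc z` before it and `z` after it.
active⇒activeAfter {suc z} {ys} zs ((bounds , un) , _) act bef | _ , x≤n =
  proj₂ (subst IsFishburn (insertMax-++ (zs ∷ʳ suc z) ys) act)
    (fishburnPattern⁻ (pattern-new zs (s≤s x≤n) z∈))
  where
  z∈ : z ∈ ys
  z∈ = before⇒after zs (subst Unique (∷ʳ-++ zs (suc z) ys) un)
    (subst (λ π → Before π (suc z) z) (∷ʳ-++ zs (suc z) ys) bef)

activeAfter⇒active : ∀ zs → IsFishburn ((zs ∷ʳ x) ++ ys) → ActiveAfter ((zs ∷ʳ x) ++ ys) x →
                     Active ((zs ∷ʳ x) ++ ys) (length (zs ∷ʳ x))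
activeAfter⇒active {x = x} {ys = ys} zs fish act =
  subst IsFishburn (sym (insertMax-++ (zs ∷ʳ x) ys)) (fishburn-insert (zs ∷ʳ x) ys fish z∉)
  where
  z∉ : ∀ {zs′ z} → zs ∷ʳ x ≡ zs′ ∷ʳ suc z → ¬ z ∈ ys
  z∉ {zs′} eq z∈ with refl , refl ← ∷ʳ-injective zs zs′ eq =
    act (subst (λ π → Before π _ _) (sym (∷ʳ-++ zs x ys)) (after⇒before zs z∈))

-- Numbers of sites

siteNumber-active : ∀ π s → Active π s → siteNumber π (suc s) ≡ suc (siteNumber π s)
siteNumber-active π s act =
  trans (cong (count (active? π)) (sym (upTo-∷ʳ s))) (count-accept-∷ʳ (active? π) (upTo s) act)

siteNumber-inactive : ∀ π s → ¬ Active π s → siteNumber π (suc s) ≡ siteNumber π s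
siteNumber-inactive π s ¬act =
  trans (cong (count (active? π)) (sym (upTo-∷ʳ s))) (count-reject-∷ʳ (active? π) (upTo s) ¬act)

-- The site in front is always active, which gives the leading `suc`; every further site follows an
-- entry of `xs`. The induction shortens `xs` from the right while `π` is fixed, hence `Reverse` and
-- the equation.
siteNumber-suc-prefix : IsFishburn π → Reverse xs → π ≡ xs ++ ys →
                        siteNumber π (suc (length xs)) ≡ suc (count (activeAfter? π) xs)
siteNumber-suc-prefix {π} fish [] _ = siteNumber-active π 0 (active-zero fish)
siteNumber-suc-prefix {π = π} {ys = ys} fish (zs ∶ rs ∶ʳ x) refl
  with ih ← siteNumber-suc-prefix {π = π} {ys = x ∷ ys} fish rs (∷ʳ-++ zs x ys)
  with activeAfter? π x
... | yes act = begin
  siteNumber π (suc (length (zs ∷ʳ x)))  ≡⟨ siteNumber-active π _ (activeAfter⇒active zs fish act) ⟩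
  suc (siteNumber π (length (zs ∷ʳ x)))  ≡⟨ cong (suc ∘ siteNumber π) (length-∷ʳ zs) ⟩
  suc (siteNumber π (suc (length zs)))   ≡⟨ cong suc ih ⟩
  suc (suc (count (activeAfter? π) zs))  ≡⟨ cong suc (count-accept-∷ʳ (activeAfter? π) zs act) ⟨
  suc (count (activeAfter? π) (zs ∷ʳ x)) ∎
  where open ≡-Reasoning
... | no ¬act = begin
  siteNumber π (suc (length (zs ∷ʳ x)))  ≡⟨ siteNumber-inactive π _ (¬act ∘ active⇒activeAfter zs fish) ⟩
  siteNumber π (length (zs ∷ʳ x))        ≡⟨ cong (siteNumber π) (length-∷ʳ zs) ⟩
  siteNumber π (suc (length zs))         ≡⟨ ih ⟩
  suc (count (activeAfter? π) zs)        ≡⟨ cong suc (count-reject-∷ʳ (activeAfter? π) zs ¬act) ⟨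
  suc (count (activeAfter? π) (zs ∷ʳ x)) ∎
  where open ≡-Reasoning

-- For nonempty `xs`, `siteNumber` includes the active site in front but omits the active one after
-- `xs`; the two cancel.
siteNumber-prefix : ∀ xs ys → IsFishburn (xs ++ ys) → Active (xs ++ ys) (length xs) →
                    siteNumber (xs ++ ys) (length xs) ≡ count (activeAfter? (xs ++ ys)) xs
siteNumber-prefix xs ys fish act with reverseView xs
... | [] = refl
... | zs ∶ rs ∶ʳ x = begin
  siteNumber σ (length (zs ∷ʳ x))        ≡⟨ cong (siteNumber σ) (length-∷ʳ zs) ⟩
  siteNumber σ (suc (length zs))         ≡⟨ siteNumber-suc-prefix {ys = x ∷ ys} fish rs (∷ʳ-++ zs x ys) ⟩
  suc (count (activeAfter? σ) zs)        ≡⟨ count-accept-∷ʳ (activeAfter? σ) zs (active⇒activeAfter zs fish act) ⟨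
  count (activeAfter? σ) (zs ∷ʳ x)       ∎
  where
  open ≡-Reasoning
  σ : List ℕ
  σ = (zs ∷ʳ x) ++ ys

-- Letters under insertion

module _ (xs ys : List ℕ) (fish : IsFishburn (xs ++ suc (length (xs ++ ys)) ∷ ys)) where

  private
    σ σ⁺ : List ℕ
    N : ℕ
    σ = xs ++ ys
    N = suc (length σ)
    σ⁺ = xs ++ N ∷ ys

    σ-fish : IsFishburn σ
    σ-fish = fishburn-uninsert xs ys fish

    <N : v ∈ σ → v < N
    <N = All.lookup (below-suc-length (proj₁ σ-fish))

  before-insert : Before σ u v → Before σ⁺ u v
  before-insert p = ⊆-trans p (⊆-insert xs)

  before-uninsert : u < N → v < N → Before σ⁺ u v → Before σ u v
  before-uninsert u<N v<N = ⊆-uninsert xs λ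
    { (here refl)         → <-irrefl refl u<N
    ; (there (here refl)) → <-irrefl refl v<N }

  activeAfter-insert : v < N → ActiveAfter σ v → ActiveAfter σ⁺ v
  activeAfter-insert v<N act p = act (before-uninsert v<N (≤-<-trans pred[n]≤n v<N) p)

  activeAfter-uninsert : ActiveAfter σ⁺ v → ActiveAfter σ v
  activeAfter-uninsert act p = act (before-insert p)

  -- The new maximum is not counted for a smaller `m`, and the order and activity of old entries
  -- persist.
  letter-insert : m < N → letter σ⁺ m ≡ letter σ m
  letter-insert {m} m<N = trans
    (count-uninsert (counted? σ⁺ m) xs (λ (N<m , _) → <-asym N<m m<N))
    (count-cong (counted? σ⁺ m) (counted? σ m) σ
      (λ v∈ (v<m , act , vm) → v<m , activeAfter-uninsert act , before-uninsert (<N v∈) m<N vm)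
      (λ v∈ (v<m , act , vm) → v<m , activeAfter-insert (<N v∈) act , before-insert vm))

  -- All entries left of `N` are smaller, so activity alone decides there; `N` and the entries right
  -- of it contribute 0.
  letter-new : letter σ⁺ N ≡ count (activeAfter? σ) xs
  letter-new = begin
    count (counted? σ⁺ N) σ⁺
      ≡⟨ count-++ (counted? σ⁺ N) xs (N ∷ ys) ⟩
    count (counted? σ⁺ N) xs + count (counted? σ⁺ N) (N ∷ ys)
      ≡⟨ cong₂ _+_ (count-cong (counted? σ⁺ N) (activeAfter? σ) xs
                     (λ _ (_ , act , _) → activeAfter-uninsert act)
                     (λ v∈ act → <N (∈-++⁺ˡ v∈) , activeAfter-insert (<N (∈-++⁺ˡ v∈)) act ,
                       ⊆-++⁺ (from∈ v∈) (refl ∷ minimum ys)))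
                   (cong length (filter-none (counted? σ⁺ N) (All.tabulate after))) ⟩
    count (activeAfter? σ) xs + 0
      ≡⟨ +-identityʳ _ ⟩
    count (activeAfter? σ) xs ∎
    where
    open ≡-Reasoning
    after : v ∈ N ∷ ys → ¬ Counted σ⁺ N v
    after (here refl) (N<N , _)    = <-irrefl refl N<N
    after (there v∈)  (_ , _ , vN) = before-asym (proj₂ (proj₁ fish)) vN (after⇒before xs v∈)

  letter-new-site : letter σ⁺ N ≡ siteNumber σ (length xs)
  letter-new-site = trans letter-new
    (sym (siteNumber-prefix xs ys σ-fish (subst IsFishburn (sym (insertMax-++ xs ys)) fish)))

  g-insert : g σ⁺ ≡ g σ ∷ʳ siteNumber σ (length xs)
  g-insert = trans (cong g (sym (insertMax-++ xs ys)))
    (g-insertMax σ (length xs) (proj₁ σ-fish) (length-++-≤ˡ xs))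

-- Each insertion appends the new letter and keeps the earlier ones. Place `m`, counted from 0,
-- holds the letter of `suc m`.
g-letters : Built π → g π ≡ map (letter π ∘ suc) (upTo (length π))
g-letters [] = refl
g-letters (insert xs ys built fish) = begin
  g σ⁺
    ≡⟨ g-insert xs ys fish ⟩
  g σ ∷ʳ siteNumber σ (length xs)
    ≡⟨ cong₂ _∷ʳ_ (g-letters built) (sym (letter-new-site xs ys fish)) ⟩
  map (letter σ ∘ suc) (upTo l) ∷ʳ letter σ⁺ (suc l)
    ≡⟨ cong (_∷ʳ letter σ⁺ (suc l))
         (map-cong-local (All.map (λ m<n → sym (letter-insert xs ys fish (s≤s m<n))) (Allₚ.all-upTo l))) ⟩
  map (letter σ⁺ ∘ suc) (upTo l) ∷ʳ letter σ⁺ (suc l)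
    ≡⟨ map-++ (letter σ⁺ ∘ suc) (upTo l) (l ∷ []) ⟨
  map (letter σ⁺ ∘ suc) (upTo l ∷ʳ l)
    ≡⟨ cong (map (letter σ⁺ ∘ suc)) (upTo-∷ʳ l) ⟩
  map (letter σ⁺ ∘ suc) (upTo (suc l))
    ≡⟨ cong (map (letter σ⁺ ∘ suc) ∘ upTo) (length-insert xs ys) ⟨
  map (letter σ⁺ ∘ suc) (upTo (length σ⁺)) ∎
  where
  open ≡-Reasoning
  σ σ⁺ : List ℕ
  l : ℕ
  σ = xs ++ ys
  l = length σ
  σ⁺ = xs ++ suc l ∷ ys

-- The number of active sites and the bijectivity of g

module _ (un : Unique π) where

  -- The active `x` found at or after `m` and before `suc m` is counted for `suc m` but not for `m`.
  letter-ascent : ¬ FishburnPattern π → Before π m (suc m) → letter π m < letter π (suc m)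
  letter-ascent ¬fp bef with active-between un ¬fp bef ≤-refl
  ... | x , x<1+m , act , m≤x , x1+m = letter-<
    (λ (v<m , actv , vm) → m≤n⇒m≤1+n v<m , actv , before-trans un vm bef)
    (λ (x<m , _ , xm) → Sum.[ <⇒≢ x<m , before-asym un xm ]′ m≤x)
    (x<1+m , act , x1+m)

  -- A value counted for `suc m` stands left of it, hence left of `m`, and so is not `m` itself.
  letter-descent : Before π (suc m) m → letter π (suc m) ≤ letter π m
  letter-descent {m} bef = letter-≤ λ (v<1+m , act , v1+m) →
    ≤∧≢⇒< (≤-pred v<1+m) (λ { refl → before-asym un bef v1+m }) , act , before-trans un v1+m bef

-- The number of active sites of π, read off from α = g(π).
sites : List ℕ → ℕ
sites []      = 1
sites (x ∷ a) = 2 + asc (x ∷ a)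

asc-∷ʳ : ∀ xs y x → asc ((xs ∷ʳ y) ∷ʳ x) ≡ asc (xs ∷ʳ y) + (if Dec.does (y <? x) then 1 else 0)
asc-∷ʳ []           y x = +-identityʳ _
asc-∷ʳ (z ∷ [])     y x = trans (cong (bit +_) (asc-∷ʳ [] y x)) (sym (+-assoc bit 0 _))
  where bit = if Dec.does (z <? y) then 1 else 0
asc-∷ʳ (z ∷ w ∷ xs) y x = trans (cong (bit +_) (asc-∷ʳ (w ∷ xs) y x)) (sym (+-assoc bit (asc (w ∷ xs ∷ʳ y)) _))
  where bit = if Dec.does (z <? w) then 1 else 0

sites-∷ʳ : ∀ xs → sites (xs ∷ʳ x) ≡ 2 + asc (xs ∷ʳ x)
sites-∷ʳ []      = refl
sites-∷ʳ (_ ∷ _) = refl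

asc-ascent : ∀ xs → y < x → asc ((xs ∷ʳ y) ∷ʳ x) ≡ suc (asc (xs ∷ʳ y))
asc-ascent {y} {x} xs y<x = trans (asc-∷ʳ xs y x)
  (trans (cong (λ b → asc (xs ∷ʳ y) + (if b then 1 else 0)) (dec-true (y <? x) y<x)) (+-comm _ 1))

asc-descent : ∀ xs → x ≤ y → asc ((xs ∷ʳ y) ∷ʳ x) ≡ asc (xs ∷ʳ y)
asc-descent {x} {y} xs x≤y = trans (asc-∷ʳ xs y x)
  (trans (cong (λ b → asc (xs ∷ʳ y) + (if b then 1 else 0)) (dec-false (y <? x) (≤⇒≯ x≤y))) (+-identityʳ _))

sites-ascent : ∀ xs → y < x → sites ((xs ∷ʳ y) ∷ʳ x) ≡ suc (sites (xs ∷ʳ y))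
sites-ascent {y} xs y<x =
  trans (sites-∷ʳ (xs ∷ʳ y)) (trans (cong (2 +_) (asc-ascent xs y<x)) (cong suc (sym (sites-∷ʳ xs))))

sites-descent : ∀ xs → x ≤ y → sites ((xs ∷ʳ y) ∷ʳ x) ≡ sites (xs ∷ʳ y)
sites-descent xs x≤y =
  trans (sites-∷ʳ (xs ∷ʳ _)) (trans (cong (2 +_) (asc-descent xs x≤y)) (sym (sites-∷ʳ xs)))

module _ (xs ys : List ℕ) (fish : IsFishburn (xs ++ suc (length (xs ++ ys)) ∷ ys)) where

  private
    σ σ⁺ : List ℕ
    N : ℕ
    σ = xs ++ ys
    N = suc (length σ)
    σ⁺ = xs ++ N ∷ ys

    un : Unique σ⁺
    un = proj₂ (proj₁ fish)

  count-active-insert : count (activeAfter? σ⁺) σ ≡ count (activeAfter? σ) σ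
  count-active-insert = count-cong (activeAfter? σ⁺) (activeAfter? σ) σ
    (λ _ → activeAfter-uninsert xs ys fish)
    (λ v∈ → activeAfter-insert xs ys fish
      (All.lookup (below-suc-length (proj₁ (fishburn-uninsert xs ys fish))) v∈))

  -- Only the site after `N` can add to the count. It is active exactly when `N - 1` is left of `N`,
  -- that is, when their letters form an ascent. The equation for the length provides a previous
  -- letter.
  sites-insert : suc (count (activeAfter? σ) σ) ≡ sites (g σ) → g σ ≡ map (letter σ ∘ suc) (upTo (length σ)) →
                 length σ ≡ suc k → suc (count (activeAfter? σ⁺) σ⁺) ≡ sites (g σ⁺)
  sites-insert {k} ih gσ len = go (activeAfter? σ⁺ N)
    where
    open ≡-Reasoning
    front = map (letter σ ∘ suc) (upTo k)

    gσ′ : g σ ≡ front ∷ʳ letter σ⁺ (length σ)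
    gσ′ = begin
      g σ                                                ≡⟨ gσ ⟩
      map (letter σ ∘ suc) (upTo (length σ))             ≡⟨ cong (map (letter σ ∘ suc) ∘ upTo) len ⟩
      map (letter σ ∘ suc) (upTo (suc k))                ≡⟨ cong (map (letter σ ∘ suc)) (upTo-∷ʳ k) ⟨
      map (letter σ ∘ suc) (upTo k ∷ʳ k)                 ≡⟨ map-++ (letter σ ∘ suc) (upTo k) (k ∷ []) ⟩
      front ∷ʳ letter σ (suc k)                          ≡⟨ cong (λ m → front ∷ʳ letter σ m) len ⟨
      front ∷ʳ letter σ (length σ)                       ≡⟨ cong (front ∷ʳ_) (letter-insert xs ys fish ≤-refl) ⟨
      front ∷ʳ letter σ⁺ (length σ) ∎

    gσ⁺ : g σ⁺ ≡ (front ∷ʳ letter σ⁺ (length σ)) ∷ʳ letter σ⁺ N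
    gσ⁺ = trans (g-insert xs ys fish) (cong₂ _∷ʳ_ gσ′ (sym (letter-new-site xs ys fish)))

    predN∈ : length σ ∈ σ⁺
    predN∈ = ∈-permutation (proj₁ fish) (subst (1 ≤_) (sym len) (s≤s z≤n))
      (≤-trans (n≤1+n _) (≤-reflexive (sym (length-insert xs ys))))

    go : Dec (ActiveAfter σ⁺ N) → suc (count (activeAfter? σ⁺) σ⁺) ≡ sites (g σ⁺)
    go (yes act) with before-total predN∈ (∈-insert xs) (<⇒≢ ≤-refl)
    ... | inj₂ bef = contradiction bef act
    ... | inj₁ bef = begin
      suc (count (activeAfter? σ⁺) σ⁺)       ≡⟨ cong suc (count-insert (activeAfter? σ⁺) xs act) ⟩
      2 + count (activeAfter? σ⁺) σ          ≡⟨ cong (2 +_) count-active-insert ⟩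
      2 + count (activeAfter? σ) σ           ≡⟨ cong suc ih ⟩
      suc (sites (g σ))                      ≡⟨ cong (suc ∘ sites) gσ′ ⟩
      suc (sites (front ∷ʳ letter σ⁺ (length σ))) ≡⟨ sites-ascent front (letter-ascent un (proj₂ fish ∘ fishburnPattern⁻) bef) ⟨
      sites ((front ∷ʳ letter σ⁺ (length σ)) ∷ʳ letter σ⁺ N) ≡⟨ cong sites gσ⁺ ⟨
      sites (g σ⁺) ∎
    go (no ¬act) = begin
      suc (count (activeAfter? σ⁺) σ⁺)       ≡⟨ cong suc (count-uninsert (activeAfter? σ⁺) xs ¬act) ⟩
      1 + count (activeAfter? σ⁺) σ          ≡⟨ cong suc count-active-insert ⟩
      1 + count (activeAfter? σ) σ           ≡⟨ ih ⟩
      sites (g σ)                            ≡⟨ cong sites gσ′ ⟩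
      sites (front ∷ʳ letter σ⁺ (length σ))  ≡⟨ sites-descent front (letter-descent un (decidable-stable (before? σ⁺ _ _) ¬act)) ⟨
      sites ((front ∷ʳ letter σ⁺ (length σ)) ∷ʳ letter σ⁺ N) ≡⟨ cong sites gσ⁺ ⟨
      sites (g σ⁺) ∎

count-active : Built π → suc (count (activeAfter? π) π) ≡ sites (g π)
count-active [] = refl
-- A single entry has no previous letter, so this case is computed.
count-active (insert [] [] _ _) = refl
count-active (insert [] (y ∷ ys) built fish) =
  sites-insert [] (y ∷ ys) fish (count-active built) (g-letters built) refl
count-active (insert (x ∷ xs) ys built fish) =
  sites-insert (x ∷ xs) ys fish (count-active built) (g-letters built) refl

-- Sites run from 0 to `length π`, so counting below `suc (length π)` takes in all of them.
siteNumber-total : Built π → siteNumber π (suc (length π)) ≡ sites (g π)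
siteNumber-total {π} built = trans
  (siteNumber-suc-prefix {ys = []} (built⇒fishburn built) (reverseView π) (sym (++-identityʳ π)))
  (count-active built)

siteNumber-step : ∀ π s → siteNumber π s ≤ siteNumber π (suc s)
siteNumber-step π s with active? π s
... | yes act = ≤-trans (n≤1+n _) (≤-reflexive (sym (siteNumber-active π s act)))
... | no ¬act = ≤-reflexive (sym (siteNumber-inactive π s ¬act))

siteNumber-mono : ∀ π t → s ≤ t → siteNumber π s ≤ siteNumber π t
siteNumber-mono {s} π t s≤t with m≤n⇒m<n∨m≡n s≤t
... | inj₂ refl = ≤-refl
siteNumber-mono {s} π (suc t) _ | inj₁ (s≤s s≤t) = ≤-trans (siteNumber-mono π t s≤t) (siteNumber-step π t)

siteNumber-< : Active π s → s < t → siteNumber π s < siteNumber π t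
siteNumber-< {π} {s} {t} act s<t =
  ≤-trans (≤-reflexive (sym (siteNumber-active π s act))) (siteNumber-mono π t s<t)

siteNumber-injective : Active π s → Active π t → siteNumber π s ≡ siteNumber π t → s ≡ t
siteNumber-injective {π} {s} {t} acts actt eq with <-cmp s t
... | tri< s<t _ _ = contradiction eq (<⇒≢ (siteNumber-< {π} acts s<t))
... | tri≈ _ s≡t _ = s≡t
... | tri> _ _ t<s = contradiction (sym eq) (<⇒≢ (siteNumber-< {π} actt t<s))

-- `siteNumber` rises from 0 by at most 1 at a time, and only past an active site, so no value is
-- skipped.
siteNumber-surjective : ∀ π t → x < siteNumber π t → ∃[ s ] (Active π s × siteNumber π s ≡ x × s < t)
siteNumber-surjective {x} π (suc t) x< with x <? siteNumber π t
... | yes x<′ with s , act , eq , s<t ← siteNumber-surjective π t x<′ = s , act , eq , m≤n⇒m≤1+n s<t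
... | no x≮ with active? π t
...   | no ¬act = contradiction (≤-trans x< (≤-reflexive (siteNumber-inactive π t ¬act))) x≮
...   | yes act = t , act ,
  ≤-antisym (≮⇒≥ x≮) (≤-pred (≤-trans x< (≤-reflexive (siteNumber-active π t act)))) , ≤-refl

-- For `h = sites` these are the ascent sequences: `sites [] = 1` forces the first letter to be 0,
-- and later the strict bound `2 + asc` means at most `1 + asc`. A general `h` can absorb the first
-- letter in inductions.
Bounded : (List ℕ → ℕ) → Pred (List ℕ) 0ℓ
Bounded h a = ∀ (j : Fin (length a)) → lookup a j < h (take (toℕ j) a)

bounded-∷ʳ⁺ : ∀ h a → Bounded h a → x < h a → Bounded h (a ∷ʳ x)
bounded-∷ʳ⁺ h []      _ x< zero    = x<
bounded-∷ʳ⁺ h (y ∷ a) b x< zero    = b zero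
bounded-∷ʳ⁺ h (y ∷ a) b x< (suc j) = bounded-∷ʳ⁺ (h ∘ (y ∷_)) a (b ∘ suc) x< j

bounded-∷ʳ⁻ : ∀ h a → Bounded h (a ∷ʳ x) → Bounded h a × x < h a
bounded-∷ʳ⁻ h []      b = (λ ()) , b zero
bounded-∷ʳ⁻ h (y ∷ a) b with b′ , x< ← bounded-∷ʳ⁻ (h ∘ (y ∷_)) a (b ∘ suc) =
  (λ { zero → b zero ; (suc j) → b′ j }) , x<

bounded⇒ascent : Bounded sites α → IsAscentSequence α
bounded⇒ascent {x ∷ α} b zero    = (λ _ → n<1⇒n≡0 (b zero)) , λ ()
bounded⇒ascent {x ∷ α} b (suc j) = (λ ()) , λ _ → ≤-pred (b (suc j))

ascent⇒bounded : IsAscentSequence α → Bounded sites α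
ascent⇒bounded {x ∷ α} asc zero    = s≤s (≤-reflexive (proj₁ (asc zero) refl))
ascent⇒bounded {x ∷ α} asc (suc j) = s≤s (proj₂ (asc (suc j)) (s≤s z≤n))

active-insert : ∀ xs ys → IsFishburn (xs ++ suc (length (xs ++ ys)) ∷ ys) → Active (xs ++ ys) (length xs)
active-insert xs ys = subst IsFishburn (sym (insertMax-++ xs ys))

-- A letter is the number of an active site, hence less than the number of all active sites.
g-bounded : Built π → Bounded sites (g π)
g-bounded [] ()
g-bounded (insert xs ys built fish) = subst (Bounded sites) (sym (g-insert xs ys fish))
  (bounded-∷ʳ⁺ sites (g (xs ++ ys)) (g-bounded built) (≤-trans
    (siteNumber-< {xs ++ ys} (active-insert xs ys fish) (s≤s (length-++-≤ˡ xs)))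
    (≤-reflexive (siteNumber-total built))))

-- The last letter `x` is below the number of active sites of the permutation built from the earlier
-- letters, so one of these sites has number `x`.
g-surjective : Reverse α → Bounded sites α → ∃[ π ] (IsFishburn π × g π ≡ α)
g-surjective [] _ = [] , built⇒fishburn [] , refl
g-surjective (α ∶ rs ∶ʳ x) b
  with b′ , x< ← bounded-∷ʳ⁻ sites α b
  with π , fish , gπ≡α ← g-surjective rs b′
  with s , act , site≡x , s<1+n ← siteNumber-surjective π (suc (length π))
         (subst (x <_) (trans (cong sites (sym gπ≡α)) (sym (siteNumber-total (fishburn⇒built _ refl fish)))) x<)
  = insertMax π s , act ,
    trans (g-insertMax π s (proj₁ fish) (≤-pred s<1+n)) (cong₂ _∷ʳ_ gπ≡α site≡x)

length-g : ∀ π → length (g π) ≡ length π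
length-g π = trans (length-map _ (upTo (length π))) (length-upTo (length π))

-- By induction, the letters before the last determine the permutation without its maximum. The last
-- one then determines the site, since active sites have different numbers.
g-injective : Built π → Built ρ → g π ≡ g ρ → π ≡ ρ
g-injective [] [] _ = refl
g-injective {ρ = ρ} [] (insert xs ys _ _) eq =
  contradiction (trans (cong length eq) (trans (length-g ρ) (length-insert xs ys))) λ ()
g-injective {π = π} (insert xs ys _ _) [] eq =
  contradiction (trans (sym (cong length eq)) (trans (length-g π) (length-insert xs ys))) λ ()
g-injective (insert xs ys built fish) (insert xs′ ys′ built′ fish′) eq =
  trans (sym (insertMax-++ xs ys)) (trans (cong₂ insertMax same-rest same-site) (insertMax-++ xs′ ys′))
  where
  eq′ : g (xs ++ ys) ≡ g (xs′ ++ ys′) × siteNumber (xs ++ ys) (length xs) ≡ siteNumber (xs′ ++ ys′) (length xs′)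
  eq′ = ∷ʳ-injective (g (xs ++ ys)) (g (xs′ ++ ys′))
    (trans (sym (g-insert xs ys fish)) (trans eq (g-insert xs′ ys′ fish′)))

  same-rest : xs ++ ys ≡ xs′ ++ ys′
  same-rest = g-injective built built′ (proj₁ eq′)

  same-site : length xs ≡ length xs′
  same-site = siteNumber-injective {xs ++ ys} (active-insert xs ys fish)
    (subst (λ π → Active π (length xs′)) (sym same-rest) (active-insert xs′ ys′ fish′))
    (trans (proj₂ eq′) (cong (λ π → siteNumber π (length xs′)) (sym same-rest)))

-- Pattern containment and enumeration

-- A pair holds an entry and its letter in the pattern. There is no case of ties, as the letters of
-- 3412 and of 201 are distinct.
Compatible : ℕ × ℕ → ℕ × ℕ → Set
Compatible (x , u) (y , v) = (x < y × u < v) ⊎ (y < x × v < u)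

compatible-⇔ : Compatible (x , u) (y , v) → (x < y ⇔ u < v) × (y < x ⇔ v < u)
compatible-⇔ (inj₁ (x<y , u<v)) =
  mk⇔ (λ _ → u<v) (λ _ → x<y) , mk⇔ (contradiction x<y ∘ <⇒≯) (contradiction u<v ∘ <⇒≯)
compatible-⇔ (inj₂ (y<x , v<u)) =
  mk⇔ (contradiction y<x ∘ <⇒≯) (contradiction v<u ∘ <⇒≯) , mk⇔ (λ _ → v<u) (λ _ → y<x)

compatible-lookup : ∀ {p} {ps : List (ℕ × ℕ)} (eq : length (map proj₁ ps) ≡ length (map proj₂ ps)) →
  All (Compatible p) ps → ∀ j → Compatible p (lookup (map proj₁ ps) j , lookup (map proj₂ ps) (cast eq j))
compatible-lookup eq (c ∷ _)  zero    = c
compatible-lookup eq (_ ∷ cs) (suc j) = compatible-lookup (suc-injective eq) cs j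

sameRelativeOrder : ∀ {ps} → AllPairs Compatible ps → SameRelativeOrder (map proj₁ ps) (map proj₂ ps)
sameRelativeOrder [] = refl , λ ()
sameRelativeOrder (cs ∷ css) with eq , same ← sameRelativeOrder css = cong suc eq , λ where
  zero    zero    → mk⇔ (λ p → contradiction p (<-irrefl refl)) (λ p → contradiction p (<-irrefl refl))
  zero    (suc j) → proj₁ (compatible-⇔ (compatible-lookup eq cs j))
  (suc i) zero    → proj₂ (compatible-⇔ (compatible-lookup eq cs i))
  (suc i) (suc j) → same i j

infix 4 _⇔-dec_
_⇔-dec_ : ∀ {A B : Set} → Dec A → Dec B → Dec (A ⇔ B)
a? ⇔-dec b? = map′ (λ (f , g) → mk⇔ f g) (λ e → Equivalence.to e , Equivalence.from e)
  ((a? →-dec b?) ×-dec (b? →-dec a?))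

sameRelativeOrder? : ∀ γ β → Dec (SameRelativeOrder γ β)
sameRelativeOrder? γ β with length γ ≟ length β
... | no neq = no (neq ∘ proj₁)
... | yes eq = map′ (eq ,_) proj₂ (Finₚ.all? λ i → Finₚ.all? λ j →
  (lookup γ i <? lookup γ j) ⇔-dec (lookup β (cast eq i) <? lookup β (cast eq j)))

-- The entry `x` is either dropped or kept; a kept `x` is absorbed into the predicate.
anySublist? : {Q : Pred (List ℕ) 0ℓ} → Decidable Q → ∀ xs → Dec (∃[ γ ] (γ ⊆ xs × Q γ))
anySublist? Q? [] = map′ (λ q → [] , [] , q) (λ { ([] , [] , q) → q }) (Q? [])
anySublist? Q? (x ∷ xs) = map′
  Sum.[ (λ (γ , p , q) → γ , x ∷ˢ p , q) , (λ (γ , p , q) → x ∷ γ , refl ∷ p , q) ]′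
  (λ { (γ , _ ∷ˢ p , q) → inj₁ (γ , p , q) ; (_ , refl ∷ p , q) → inj₂ (_ , p , q) })
  (anySublist? Q? xs ⊎-dec anySublist? (Q? ∘ (x ∷_)) xs)

contains? : ∀ s β → Dec (Contains s β)
contains? s β = anySublist? (λ γ → sameRelativeOrder? γ β) s

contains-3412 : Contains π (3 ∷ 4 ∷ 1 ∷ 2 ∷ []) ⇔ Occurrence3412 π
contains-3412 {π} = mk⇔ to from
  where
  to : Contains π (3 ∷ 4 ∷ 1 ∷ 2 ∷ []) → Occurrence3412 π
  to (c ∷ d ∷ a ∷ b ∷ [] , cdab , _ , same) = a , b , c , d , cdab ,
    -- The values of 3412 increase along the places 2, 3, 0, 1, so three comparisons suffice.
    Equivalence.from (same (# 2) (# 3)) (from-yes (1 <? 2)) ,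
    Equivalence.from (same (# 3) (# 0)) (from-yes (2 <? 3)) ,
    Equivalence.from (same (# 0) (# 1)) (from-yes (3 <? 4))

  from : Occurrence3412 π → Contains π (3 ∷ 4 ∷ 1 ∷ 2 ∷ [])
  from (a , b , c , d , cdab , a<b , b<c , c<d) = _ , cdab ,
    sameRelativeOrder {(c , 3) ∷ (d , 4) ∷ (a , 1) ∷ (b , 2) ∷ []}
      ( (inj₁ (c<d , from-yes (3 <? 4)) ∷ inj₂ (<-trans a<b b<c , from-yes (1 <? 3)) ∷ inj₂ (b<c , from-yes (2 <? 3)) ∷ [])
      ∷ (inj₂ (<-trans a<b (<-trans b<c c<d) , from-yes (1 <? 4)) ∷ inj₂ (<-trans b<c c<d , from-yes (2 <? 4)) ∷ [])
      ∷ (inj₁ (a<b , from-yes (1 <? 2)) ∷ [])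
      ∷ [] ∷ [])

before⇒related : ∀ {R : ℕ → ℕ → Set} → AllPairs R xs → Before xs u v → R u v
before⇒related (_ ∷ rs) (_ ∷ˢ p)   = before⇒related rs p
before⇒related (r ∷ _)  (refl ∷ p) = All.lookup r (to∈ p)

before-upTo⁻ : Before (upTo n) u v → u < v
before-upTo⁻ {n} = before⇒related (AllPairsₚ.applyUpTo⁺₁ id n (λ i<j _ → i<j))

before-upTo⁺ : u < v → v < n → Before (upTo n) u v
before-upTo⁺ {n = n} u<v v<n with before-total (∈-upTo⁺ (<-trans u<v v<n)) (∈-upTo⁺ v<n) (<⇒≢ u<v)
... | inj₁ uv = uv
... | inj₂ vu = contradiction u<v (<⇒≯ (before-upTo⁻ {n} vu))

⊆-map⁻ : ∀ (f : ℕ → ℕ) {xs} → γ ⊆ map f xs → ∃[ δ ] (δ ⊆ xs × γ ≡ map f δ)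
⊆-map⁻ f {[]}     []         = [] , [] , refl
⊆-map⁻ f {x ∷ xs} (_ ∷ˢ p)   with δ , q , eq ← ⊆-map⁻ f p = δ , x ∷ˢ q , eq
⊆-map⁻ f {x ∷ xs} (refl ∷ p) with δ , q , eq ← ⊆-map⁻ f p = x ∷ δ , refl ∷ q , cong (f x ∷_) eq

-- Sublists of a mapped `upTo` are images of increasing index lists, and index `i` belongs to the
-- value `suc i`.
contains-201 : IsPermutation π →
  Contains (map (letter π ∘ suc) (upTo (length π))) (2 ∷ 0 ∷ 1 ∷ []) ⇔ Letters201 π
contains-201 {π} perm@(bounds , _) = mk⇔ to from
  where
  l : ℕ
  l = length π
  f : ℕ → ℕ
  f = letter π ∘ suc

  suc∈ : i ∈ upTo l → suc i ∈ π
  suc∈ i∈ = ∈-permutation perm (s≤s z≤n) (∈-upTo⁻ i∈)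

  to : Contains (map f (upTo l)) (2 ∷ 0 ∷ 1 ∷ []) → Letters201 π
  to (γ@(_ ∷ _ ∷ _ ∷ []) , γ⊆ , _ , same) with (i ∷ j ∷ k ∷ [] , ijk , refl) ← ⊆-map⁻ f γ⊆ =
    suc i , suc j , suc k , suc∈ (to∈ ijk) , suc∈ (∈ˡ jk) , suc∈ (∈ʳ jk) ,
    s≤s (before-upTo⁻ {l} (⊆-trans (refl ∷ refl ∷ _ ∷ˢ []) ijk)) , s≤s (before-upTo⁻ {l} jk) ,
    Equivalence.from (same (# 1) (# 2)) (from-yes (0 <? 1)) ,
    Equivalence.from (same (# 2) (# 0)) (from-yes (1 <? 2))
    where jk = ∷ˡ⁻ ijk

  from : Letters201 π → Contains (map f (upTo l)) (2 ∷ 0 ∷ 1 ∷ [])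
  from (i , j , k , i∈ , j∈ , k∈ , i<j , j<k , fj<fk , fk<fi)
    with All.lookup bounds i∈ | All.lookup bounds j∈ | All.lookup bounds k∈
  from (suc i , suc j , suc k , i∈ , j∈ , k∈ , s≤s i<j , s≤s j<k , fj<fk , fk<fi) | _ | _ , j<l | _ , k<l =
    _ , ⊆-map⁺ f (before-∷-⊆ (Uniqueₚ.upTo⁺ l) (before-upTo⁺ i<j j<l) (before-upTo⁺ j<k k<l)) ,
    sameRelativeOrder {(f i , 2) ∷ (f j , 0) ∷ (f k , 1) ∷ []}
      ( (inj₂ (<-trans fj<fk fk<fi , from-yes (0 <? 2)) ∷ inj₂ (fk<fi , from-yes (1 <? 2)) ∷ [])
      ∷ (inj₁ (fj<fk , from-yes (0 <? 1)) ∷ [])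
      ∷ [] ∷ [])

avoids-⇔ : IsFishburn π → Avoids π (3 ∷ 4 ∷ 1 ∷ 2 ∷ []) ⇔ Avoids (g π) (2 ∷ 0 ∷ 1 ∷ [])
avoids-⇔ {π} fish@(perm@(bounds , un) , ¬fp)
  = subst (λ α → Avoids π (3 ∷ 4 ∷ 1 ∷ 2 ∷ []) ⇔ Avoids α (2 ∷ 0 ∷ 1 ∷ []))
      (sym (g-letters (fishburn⇒built _ refl fish))) (mk⇔
  (λ av → av ∘ Equivalence.from contains-3412 ∘ 201⇒3412 un positive below ∘ Equivalence.to (contains-201 perm))
  (λ av → av ∘ Equivalence.from (contains-201 perm) ∘ 3412⇒201 un positive below (¬fp ∘ fishburnPattern⁻)
    ∘ Equivalence.to contains-3412))
  where
  positive : All (1 ≤_) π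
  positive = All.map proj₁ bounds

  below : ∀ {u v} → v ∈ π → 1 ≤ u → u ≤ v → u ∈ π
  below v∈ 1≤u u≤v = ∈-permutation perm 1≤u (≤-trans u≤v (proj₂ (All.lookup bounds v∈)))

-- Enumeration

words : ℕ → ℕ → List (List ℕ)
words k zero    = [] ∷ []
words k (suc n) = cartesianProductWith _∷_ (upTo k) (words k n)

∈-words : ∀ n → length xs ≡ n → All (_< k) xs → xs ∈ words k n
∈-words {xs = []} zero   _  _          = here refl
∈-words {xs = x ∷ xs} (suc n) eq (x<k ∷ <k) =
  ∈-cartesianProductWith⁺ _∷_ (∈-upTo⁺ x<k) (∈-words n (suc-injective eq) <k)

words-unique : ∀ k n → Unique (words k n)
words-unique k zero    = [] ∷ []
words-unique k (suc n) =
  Uniqueₚ.cartesianProductWith⁺ _∷_ ∷-injective (Uniqueₚ.upTo⁺ k) (words-unique k n)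

-- Injectivity is asked on `xs` only, since `g-injective` concerns Fishburn permutations.
map-unique : {A B : Set} {f : A → B} {xs : List A} → (∀ {x y} → x ∈ xs → y ∈ xs → f x ≡ f y → x ≡ y) →
             Unique xs → Unique (map f xs)
map-unique inj [] = []
map-unique inj (x≢ ∷ un) =
  Allₚ.map⁺ (All.tabulate λ y∈ eq → All.lookup x≢ y∈ (inj (here refl) (there y∈) eq))
  ∷ map-unique (λ x∈ y∈ → inj (there x∈) (there y∈)) un

F? : ∀ n β → Decidable (F n β)
F? n β π = isFishburn? π ×-dec (length π ≟ n) ×-dec ¬? (contains? π β)

-- Entries of a permutation of length `n` are at most `n`, so words over 0 to `n` include them all.
fishburns : ℕ → List ℕ → List (List ℕ)
fishburns n β = filter (F? n β) (words (suc n) n)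

∈-fishburns : ∀ n β π → π ∈ fishburns n β ⇔ F n β π
∈-fishburns n β π = mk⇔ (λ p → proj₂ (∈-filter⁻ (F? n β) {xs = words (suc n) n} p)) from
  where
  from : F n β π → π ∈ fishburns n β
  from p@(((bounds , _) , _) , refl , _) =
    ∈-filter⁺ (F? n β) (∈-words n refl (All.map (s≤s ∘ proj₂) bounds)) p

proposition3p4 : ((π α : List ℕ) → IsFishburn π → g π ≡ α →
    (Avoids π (3 ∷ 4 ∷ 1 ∷ 2 ∷ []) ⇔ Avoids α (2 ∷ 0 ∷ 1 ∷ [])))
    × ((n : ℕ) → ∃[ k ] (HasCardinality (F n (3 ∷ 4 ∷ 1 ∷ 2 ∷ [])) k × HasCardinality (A n (2 ∷ 0 ∷ 1 ∷ [])) k))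
proposition3p4 = (λ { π _ fish refl → avoids-⇔ fish }) , λ n →
  length (Fs n) ,
  (Fs n , Fs-unique n , ∈-fishburns n 3412′ , refl) ,
  -- The ascent sequences are listed as images under `g`, so both lists have the same length.
  (map g (Fs n) , map-unique (injective n) (Fs-unique n) , (λ α → mk⇔ (to n) (from n)) , length-map g (Fs n))
  where
  3412′ = 3 ∷ 4 ∷ 1 ∷ 2 ∷ []

  Fs : ℕ → List (List ℕ)
  Fs n = fishburns n 3412′

  Fs-unique : ∀ n → Unique (Fs n)
  Fs-unique n = Uniqueₚ.filter⁺ (F? n 3412′) (words-unique (suc n) n)

  member : ∀ n → π ∈ Fs n → F n 3412′ π
  member n = Equivalence.to (∈-fishburns n 3412′ _)

  injective : ∀ n → π ∈ Fs n → ρ ∈ Fs n → g π ≡ g ρ → π ≡ ρ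
  injective n π∈ ρ∈ = g-injective
    (fishburn⇒built _ refl (proj₁ (member n π∈))) (fishburn⇒built _ refl (proj₁ (member n ρ∈)))

  to : ∀ n → α ∈ map g (Fs n) → A n (2 ∷ 0 ∷ 1 ∷ []) α
  to n α∈ with π , π∈ , α≡gπ ← ∈-map⁻ g α∈ with fish , len , av ← member n π∈ =
    subst (A n (2 ∷ 0 ∷ 1 ∷ [])) (sym α≡gπ)
      ( bounded⇒ascent (g-bounded (fishburn⇒built _ refl fish))
      , trans (length-g π) len
      , Equivalence.to (avoids-⇔ fish) av )

  from : ∀ n → A n (2 ∷ 0 ∷ 1 ∷ []) α → α ∈ map g (Fs n)
  from {α} n (asc , len , av) with π , fish , gπ≡α ← g-surjective (reverseView α) (ascent⇒bounded asc) =
    subst (_∈ map g (Fs n)) gπ≡α (∈-map⁺ g (Equivalence.from (∈-fishburns n 3412′ π)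
      ( fish
      , trans (sym (length-g π)) (trans (cong length gπ≡α) len)
      , Equivalence.from (avoids-⇔ fish) (subst (λ a → Avoids a (2 ∷ 0 ∷ 1 ∷ [])) (sym gπ≡α) av))))
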